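{- Let $t$ and $i$ be integers with $t \geq 1$ and $0 \leq i < t$, and suppose there exists a Hadamard matrix of order $4t+4i$. Then there exists a binary code (not necessarily linear) $C \subseteq \{0,1\}^{4t}$ of length $4t$ with exactly $8t+8i$ codewords and minimum distance at least $2t-2i$, i.e. any two distinct codewords of $C$ are at Hamming distance at least $2t-2i$.
   Context: A Hadamard matrix of order $n$ is an $n \times n$ matrix $H$ with entries in $\{\pm 1\}$ satisfying $HH^{\top} = nI_n$. A binary code of length $m$ is a subset of $\{0,1\}^m$; its minimum distance is the minimum Hamming distance between two distinct codewords. -}

module Defs where

open import Algebra.Properties.Semiring.Sum using (sum)
open import Data.Bool using (Bool; if_then_else_)
import Data.Bool.Properties as Bool
import Data.Fin.Properties as Fin
open import Data.Integer as ℤ using (ℤ; +_; 0ℤ; 1ℤ; -1ℤ)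
import Data.Integer.Properties as ℤ
open import Data.List using (length)
open import Data.List.Membership.Propositional using (_∈_)
open import Data.List.Relation.Unary.Unique.Propositional using (Unique)
open import Data.Nat using (ℕ; _≤_)
open import Data.Product using (_×_; _,_; ∃-syntax)
open import Data.Sum using (_⊎_)
open import Data.Vec using (Vec; count; zip)
open import Data.Vec.Functional using (Vector; transpose)
open import Function.Bundles using (_⇔_)
open import Level using (0ℓ)
open import Relation.Binary.PropositionalEquality using (_≡_; _≢_)
open import Relation.Nullary.Decidable using (does; ¬?)
open import Relation.Unary using (Pred)

Matrix : ℕ → ℕ → Set
Matrix m n = Vector (Vector ℤ n) m

infixl 7 _⊗_
infixr 8 _•_

_⊗_ : ∀ {l m n} → Matrix l m → Matrix m n → Matrix l n
(A ⊗ B) i j = sum ℤ.+-*-semiring (λ k → A i k ℤ.* B k j)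

_•_ : ∀ {m n} → ℤ → Matrix m n → Matrix m n
(c • A) i j = c ℤ.* A i j

𝕀 : ∀ n → Matrix n n
𝕀 n i j = if does (i Fin.≟ j) then 1ℤ else 0ℤ

-- Matrices are functions, so the matrix equation is stated entrywise.
record IsHadamard {n : ℕ} (H : Matrix n n) : Set where
  field
    entries : ∀ i j → H i j ≡ 1ℤ ⊎ H i j ≡ -1ℤ
    HHᵀ≡nI  : ∀ i j → (H ⊗ transpose H) i j ≡ ((+ n) • 𝕀 n) i j

Word : ℕ → Set
Word m = Vec Bool m

Code : ℕ → Set₁
Code m = Pred (Word m) 0ℓ

-- The codewords are exactly the entries of a repetition-free list of length k.
HasSize : ∀ {m} → Code m → ℕ → Set
HasSize {m} C k =
  ∃[ ws ] (Unique ws × length ws ≡ k × (∀ (w : Word m) → C w ⇔ w ∈ ws))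

hamming : ∀ {m} → Word m → Word m → ℕ
hamming u v = count (λ (x , y) → ¬? (x Bool.≟ y)) (zip u v)

MinDistanceAtLeast : ∀ {m} → Code m → ℕ → Set
MinDistanceAtLeast C d = ∀ u v → C u → C v → u ≢ v → d ≤ hamming u v

{-# OPTIONS --safe #-}

-- Read as binary words, two rows of H with inner product p are at distance
-- (n - p)/2, so the 2n rows of H and -H are pairwise at distance n/2 or n.
-- Deleting the last 4i coordinates costs at most 4i of the distance n/2 = 2t + 2i;
-- what is left is positive as i < t, so the shortened words are still distinct.
module Submission where

open import Defs
open import Algebra.Properties.Semiring.Sum using (sum; sum-cong-≗; *-distribˡ-sum)
open import Data.Bool using (Bool; true; false; _xor_)
import Data.Bool.Properties as Bool
open import Data.Empty using (⊥-elim)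
open import Data.Fin using (Fin; zero; suc; _↑ˡ_)
import Data.Fin.Properties as Fin
open import Data.Integer as ℤ using (ℤ; +_; 0ℤ; 1ℤ; -1ℤ)
import Data.Integer.Properties as ℤ
import Data.Integer.Tactic.RingSolver as ℤSolver
open import Data.List using (List; []; _∷_; length; map; cartesianProduct; allFin)
open import Data.List.Membership.Propositional using (_∈_)
open import Data.List.Membership.Propositional.Properties using (∈-map⁻)
open import Data.List.Properties using (length-map; length-++; length-tabulate)
import Data.List.Relation.Unary.All as All
open import Data.List.Relation.Unary.AllPairs using ([]; _∷_)
open import Data.List.Relation.Unary.Unique.Propositional using (Unique)
import Data.List.Relation.Unary.Unique.Propositional.Properties as Unique
open import Data.Nat using (ℕ; zero; suc; _+_; _*_; _∸_; _≤_; _<_; s≤s)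
open import Data.Nat.Properties
open import Data.Nat.Tactic.RingSolver using (solve-∀)
open import Data.Product using (_×_; _,_; Σ-syntax)
open import Data.Product.Properties using (≡-dec)
open import Data.Sum using (_⊎_; inj₁; inj₂)
open import Data.Vec using ([]; _∷_; tabulate; zip)
open import Data.Vec.Functional using (Vector)
open import Data.Vec.Properties using (count≤n)
open import Function using (_∘_; id)
open import Function.Bundles using (mk⇔)
open import Relation.Binary.PropositionalEquality
open import Relation.Nullary using (yes; no)
open import Relation.Nullary.Decidable using (decidable-stable)

dist : ∀ {n} → Vector Bool n → Vector Bool n → ℕ
dist f g = hamming (tabulate f) (tabulate g)

∑ : ∀ {n} → Vector ℤ n → ℤ
∑ = sum ℤ.+-*-semiring

-- The sign character: it turns `xor` into multiplication, so complementing a word negates the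
-- corresponding row.
± : Bool → ℤ
± false = 1ℤ
± true  = -1ℤ

±-xor : ∀ a b → ± (a xor b) ≡ ± a ℤ.* ± b
±-xor false false = refl
±-xor false true  = refl
±-xor true  false = refl
±-xor true  true  = refl

-- The sign is read off the proof that `z` is a unit, so no integer has to be tested.
bit : ∀ {z} → z ≡ 1ℤ ⊎ z ≡ -1ℤ → Bool
bit (inj₁ _) = false
bit (inj₂ _) = true

±-bit : ∀ {z} (e : z ≡ 1ℤ ⊎ z ≡ -1ℤ) → ± (bit e) ≡ z
±-bit (inj₁ refl) = refl
±-bit (inj₂ refl) = refl

inner : ∀ {n} → Vector Bool n → Vector Bool n → ℤ
inner f g = ∑ (λ k → ± (f k) ℤ.* ± (g k))

-- Reduces inner products among the rows of H and -H to those among the rows of H.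
inner-xor : ∀ {n} a b (f g : Vector Bool n) →
            inner (λ k → a xor f k) (λ k → b xor g k) ≡ ± a ℤ.* ± b ℤ.* inner f g
inner-xor a b f g = begin
  inner (λ k → a xor f k) (λ k → b xor g k)
    ≡⟨ sum-cong-≗ ℤ.+-*-semiring (λ k → begin
         ± (a xor f k) ℤ.* ± (b xor g k)             ≡⟨ cong₂ ℤ._*_ (±-xor a (f k)) (±-xor b (g k)) ⟩
         (± a ℤ.* ± (f k)) ℤ.* (± b ℤ.* ± (g k))     ≡⟨ interchange (± a) (± (f k)) (± b) (± (g k)) ⟩
         (± a ℤ.* ± b) ℤ.* (± (f k) ℤ.* ± (g k))     ∎) ⟩
  ∑ (λ k → ± a ℤ.* ± b ℤ.* (± (f k) ℤ.* ± (g k)))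
    ≡⟨ *-distribˡ-sum ℤ.+-*-semiring (± a ℤ.* ± b) (λ k → ± (f k) ℤ.* ± (g k)) ⟨
  ± a ℤ.* ± b ℤ.* inner f g ∎
  where
  open ≡-Reasoning
  interchange : ∀ w x y z → (w ℤ.* x) ℤ.* (y ℤ.* z) ≡ (w ℤ.* y) ℤ.* (x ℤ.* z)
  interchange = ℤSolver.solve-∀

suc-split : ∀ p h → 1ℤ ℤ.+ (p ℤ.+ (h ℤ.+ h)) ≡ (-1ℤ ℤ.+ p) ℤ.+ ((1ℤ ℤ.+ h) ℤ.+ (1ℤ ℤ.+ h))
suc-split = ℤSolver.solve-∀

-- An agreement adds 1 to `inner`; a disagreement subtracts 1 but adds 1 to `dist`, so either way
-- the right side grows by 1. The additive form avoids halving.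
length≡inner+2*dist : ∀ {n} (f g : Vector Bool n) →
                      + n ≡ inner f g ℤ.+ (+ dist f g ℤ.+ + dist f g)
length≡inner+2*dist {zero}  f g = refl
length≡inner+2*dist {suc n} f g = trans (cong ℤ.suc (length≡inner+2*dist f′ g′)) step
  where
  f′ = f ∘ suc
  g′ = g ∘ suc
  p = inner f′ g′
  h = + dist f′ g′
  step : ℤ.suc (p ℤ.+ (h ℤ.+ h)) ≡ inner f g ℤ.+ (+ dist f g ℤ.+ + dist f g)
  step with f zero | g zero
  ... | false | false = sym (ℤ.+-assoc 1ℤ p (h ℤ.+ h))
  ... | true  | true  = sym (ℤ.+-assoc 1ℤ p (h ℤ.+ h))
  ... | false | true  = suc-split p h
  ... | true  | false = suc-split p h

inner≤0⇒length≤2*dist : ∀ {n} (f g : Vector Bool n) → inner f g ℤ.≤ 0ℤ → n ≤ dist f g + dist f g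
inner≤0⇒length≤2*dist {n} f g p≤0 = ℤ.drop‿+≤+ (begin
  + n                      ≡⟨ length≡inner+2*dist f g ⟩
  inner f g ℤ.+ + (h + h)  ≤⟨ ℤ.+-monoˡ-≤ (+ (h + h)) p≤0 ⟩
  0ℤ ℤ.+ + (h + h)         ≡⟨ ℤ.+-identityˡ _ ⟩
  + (h + h)                ∎)
  where
  open ℤ.≤-Reasoning
  h = dist f g

hamming-self : ∀ {m} (u : Word m) → hamming u u ≡ 0
hamming-self []          = refl
hamming-self (false ∷ u) = hamming-self u
hamming-self (true  ∷ u) = hamming-self u

dist-puncture : ∀ m {k} (f g : Vector Bool (m + k)) →
                dist f g ≤ dist (λ j → f (j ↑ˡ k)) (λ j → g (j ↑ˡ k)) + k
-- Only the `k` deleted coordinates are left, each contributing at most 1.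
dist-puncture zero    f g = count≤n _ (zip (tabulate f) (tabulate g))
dist-puncture (suc m) f g with f zero | g zero | dist-puncture m (f ∘ suc) (g ∘ suc)
... | false | false | ih = ih
... | true  | true  | ih = ih
... | false | true  | ih = s≤s ih
... | true  | false | ih = s≤s ih

module SignedRows {n} {H : Matrix n n} (hadamard : IsHadamard H) where
  open IsHadamard hadamard

  row : Fin n → Vector Bool n
  row a k = bit (entries a k)

  -- The sign `true` selects the row of -H, so the pairs index all `2n` words.
  signedRow : Fin n × Bool → Vector Bool n
  signedRow (a , s) k = s xor row a k

  inner-row : ∀ a b → inner (row a) (row b) ≡ + n ℤ.* 𝕀 n a b
  inner-row a b = trans
    (sum-cong-≗ ℤ.+-*-semiring (λ k → cong₂ ℤ._*_ (±-bit (entries a k)) (±-bit (entries b k))))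
    (HHᵀ≡nI a b)

  -- Different rows are orthogonal, which gives 0; a row against its own negative gives `-n`.
  inner-signedRow≤0 : ∀ p q → p ≢ q → inner (signedRow p) (signedRow q) ℤ.≤ 0ℤ
  inner-signedRow≤0 (a , s) (b , s′) p≢q
    -- After the rewrites the left side is `± s * ± s′ * (+ n * 𝕀 n a b)`, and the test `a Fin.≟ b`
    -- evaluates the entry of `𝕀`.
    rewrite inner-xor s s′ (row a) (row b) | inner-row a b with a Fin.≟ b | s | s′
  ... | no _     | s     | s′    rewrite ℤ.*-zeroʳ (+ n) = ℤ.≤-reflexive (ℤ.*-zeroʳ (± s ℤ.* ± s′))
  ... | yes refl | false | false = ⊥-elim (p≢q refl)
  ... | yes refl | true  | true  = ⊥-elim (p≢q refl)
  ... | yes refl | false | true  rewrite ℤ.*-identityʳ (+ n) | ℤ.-1*i≡-i (+ n) = ℤ.neg-≤-pos {n} {0}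
  ... | yes refl | true  | false rewrite ℤ.*-identityʳ (+ n) | ℤ.-1*i≡-i (+ n) = ℤ.neg-≤-pos {n} {0}

  dist-signedRow : ∀ p q → p ≢ q →
                   n ≤ dist (signedRow p) (signedRow q) + dist (signedRow p) (signedRow q)
  dist-signedRow p q p≢q =
    inner≤0⇒length≤2*dist (signedRow p) (signedRow q) (inner-signedRow≤0 p q p≢q)

length-cartesianProduct : ∀ {A B : Set} (xs : List A) (ys : List B) →
                          length (cartesianProduct xs ys) ≡ length xs * length ys
length-cartesianProduct []       ys = refl
length-cartesianProduct (x ∷ xs) ys = trans (length-++ (map (x ,_) ys))
  (cong₂ _+_ (length-map (x ,_) ys) (length-cartesianProduct xs ys))

theorem2 : (t i : ℕ) → 1 ≤ t → i < t →
    Σ[ H ∈ Matrix (4 * t + 4 * i) (4 * t + 4 * i) ] IsHadamard H →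
    Σ[ C ∈ Code (4 * t) ] (HasSize C (8 * t + 8 * i) × MinDistanceAtLeast C (2 * t ∸ 2 * i))
theorem2 t i _ i<t (H , hadamard) =
  (_∈ codewords) ,
  (codewords , unique , size , λ _ → mk⇔ id id) ,
  minDistance
  where
  open SignedRows hadamard

  n = 4 * t + 4 * i

  indices : List (Fin n × Bool)
  indices = cartesianProduct (allFin n) (false ∷ true ∷ [])

  codeword : Fin n × Bool → Word (4 * t)
  codeword p = tabulate (λ k → signedRow p (k ↑ˡ (4 * i)))

  codewords : List (Word (4 * t))
  codewords = map codeword indices

  -- Assuming distinct indices rather than distinct words lets the bound serve both for injectivity
  -- of `codeword` and for the minimum distance.
  distance : ∀ p q → p ≢ q → 2 * t ∸ 2 * i ≤ hamming (codeword p) (codeword q)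
  -- Halving the chain gives `2t + 2i ≤ d + 4i`. The `4i` is split around `d`: one `2i` cancels
  -- against the left side, the other becomes the subtracted term.
  distance p q p≢q = m≤n+o⇒m∸n≤o (2 * t) (2 * i) (+-cancelʳ-≤ (2 * i) _ _ (*-cancelˡ-≤ 2 (begin
    2 * (2 * t + 2 * i)        ≡⟨ double t i ⟩
    n                          ≤⟨ dist-signedRow p q p≢q ⟩
    h + h                      ≤⟨ +-mono-≤ h≤d+4i h≤d+4i ⟩
    (d + 4 * i) + (d + 4 * i)  ≡⟨ collect d i ⟩
    2 * (2 * i + d + 2 * i)    ∎)))
    where
    open ≤-Reasoning
    d = hamming (codeword p) (codeword q)
    h = dist (signedRow p) (signedRow q)
    h≤d+4i : h ≤ d + 4 * i
    h≤d+4i = dist-puncture (4 * t) (signedRow p) (signedRow q)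
    double : ∀ t i → 2 * (2 * t + 2 * i) ≡ 4 * t + 4 * i
    double = solve-∀
    collect : ∀ d i → (d + 4 * i) + (d + 4 * i) ≡ 2 * (2 * i + d + 2 * i)
    collect = solve-∀

  codeword-injective : ∀ {p q} → codeword p ≡ codeword q → p ≡ q
  -- Index equality is decidable, so contradiction suffices: equal words at distinct indices would
  -- force `2t - 2i ≤ 0`, against `i < t`.
  codeword-injective {p} {q} eq = decidable-stable (≡-dec Fin._≟_ Bool._≟_ p q) λ p≢q →
    <⇒≱ (m<n⇒0<n∸m (*-monoʳ-< 2 i<t)) (begin
      2 * t ∸ 2 * i                      ≤⟨ distance p q p≢q ⟩
      hamming (codeword p) (codeword q)  ≡⟨ cong (hamming (codeword p)) eq ⟨
      hamming (codeword p) (codeword p)  ≡⟨ hamming-self (codeword p) ⟩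
      0                                  ∎)
    where open ≤-Reasoning

  unique : Unique codewords
  unique = Unique.map⁺ codeword-injective
    (Unique.cartesianProduct⁺ (Unique.allFin⁺ n) (((λ ()) All.∷ All.[]) ∷ All.[] ∷ []))

  size : length codewords ≡ 8 * t + 8 * i
  size = begin
    length codewords       ≡⟨ length-map codeword indices ⟩
    length indices         ≡⟨ length-cartesianProduct (allFin n) (false ∷ true ∷ []) ⟩
    length (allFin n) * 2  ≡⟨ cong (_* 2) (length-tabulate {n = n} id) ⟩
    n * 2                  ≡⟨ double t i ⟩
    8 * t + 8 * i          ∎
    where
    open ≡-Reasoning
    double : ∀ t i → (4 * t + 4 * i) * 2 ≡ 8 * t + 8 * i
    double = solve-∀

  minDistance : MinDistanceAtLeast (_∈ codewords) (2 * t ∸ 2 * i)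
  minDistance u v u∈ v∈ u≢v with ∈-map⁻ codeword u∈ | ∈-map⁻ codeword v∈
  -- Distinct words come from distinct indices because `codeword` is a function; injectivity is not
  -- involved.
  ... | p , _ , refl | q , _ , refl = distance p q (u≢v ∘ cong codeword)
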